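{- Let $L_1,L_2$ be disjoint first-order languages without function symbols, each containing at least one constant symbol, let $T_1,T_2$ be an $L_1$-theory and an $L_2$-theory, and let $T_{\mathrm{sim}}$ be the theory of simple products of $T_1$ and $T_2$. Then $T_{\mathrm{sim}}$ is distal if and only if both $T_1$ and $T_2$ are distal.
   Context: Language of simple product $L_{\mathrm{sim}}$: constant symbols $C_{(c_1,c_2)}$ for each pair of constants $c_1\in L_1$, $c_2\in L_2$; predicate symbols: those of $L_1$, those of $L_2$, and binary $\sim_1,\sim_2$. $T_\times$ states: $\sim_1,\sim_2$ are equivalence relations; $\forall x\forall y((x\sim_1y)\wedge(x\sim_2y)\to x=y)$; $\forall x\forall y\exists z((x\sim_1z)\wedge(y\sim_2z))$. Standard conversion $\widetilde\phi$ of an $L_k$-formula $\phi$: rewrite atomic formulas with constants as $\exists\bar y(R(\bar y)\wedge\bigwedge t_i=y_i)$; equality of variables $x=y$ becomes $x\sim_k y$; equality with a constant $c\in L_k$ uses $\sim_k$ and $C_{(c,d)}$ (if $k=1$) or $C_{(d,c)}$ (if $k=2$), $d$ a fixed constant of the other language; $R\in L_k$ atomic formulas unchanged; commutes with Boolean connectives and $\exists$. $T_{\mathrm{sim}}$: $T_\times$, all $\widetilde\sigma$ for $\sigma\in T_1\cup T_2$, and for each $k$ and $R\in L_k$, $\forall\bar x\forall\bar y((\bar x\sim_k\bar y)\to(R(\bar x)\leftrightarrow R(\bar y)))$. A sequence $(a_i)_{i\in I}$ is $A$-indiscernible if for all $n$, $i_1<\cdots<i_n$, $j_1<\cdots<j_n$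 and formulas $\phi$ over $A$, $\phi(a_{i_1},\ldots,a_{i_n})\leftrightarrow\phi(a_{j_1},\ldots,a_{j_n})$. A theory $T$ is distal if for every subset $A$ of the monster model and every indiscernible sequence $(a_i)_{i\in I}$ with $I=I_1+(c)+I_2$ (concatenation, $I_1,I_2$ infinite without endpoints) such that $(a_i)_{i\in I_1+I_2}$ is $A$-indiscernible, the whole sequence $(a_i)_{i\in I}$ is $A$-indiscernible. -}

module Defs where

open import Data.Empty using (⊥)
open import Data.Fin using (Fin; zero; suc; _↑ˡ_; _↑ʳ_)
open import Data.Maybe using (Maybe; just; nothing)
open import Data.Nat using (ℕ; zero; suc; _+_; _*_)
open import Data.Product using (Σ; ∃; _×_; _,_)
open import Data.Sum using (_⊎_; inj₁; inj₂)
open import Data.Sum.Relation.Binary.LeftOrder using (_⊎-<_)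
open import Data.Unit using () renaming (⊤ to Unit)
open import Data.Unit.Polymorphic using (⊤)
open import Data.Vec using (Vec; []; _∷_; _++_; allFin; concat; foldr′; lookup; map; zipWith)
open import Data.Vec.Relation.Binary.Pointwise.Inductive using (Pointwise)
open import Data.Vec.Relation.Unary.All using (All)
open import Data.Vec.Relation.Unary.Linked using (Linked)
open import Function using (_∘_; _⇔_; _↔_)
open import Level using (Level) renaming (suc to lsuc)
open import Relation.Binary using (Rel; Setoid; IsStrictTotalOrder)
open import Relation.Binary.PropositionalEquality using (_≡_)
open import Relation.Nullary using (¬_)
open import Relation.Unary using (Pred)
open import Relation.Unary.Polymorphic using (∅)

------------------------------------------------------------------------
-- First-order logic with equality, without function symbols

record Language (ℓ : Level) : Set (lsuc ℓ) where
  field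
    Constant  : Set ℓ
    Predicate : ℕ → Set ℓ

open Language public

data Term {ℓ : Level} (L : Language ℓ) (n : ℕ) : Set ℓ where
  var : Fin n → Term L n
  con : Constant L → Term L n

infix  9 _≐_
infix  8 ¬′_
infixr 7 _∧′_

-- Formula L n: formulas with free variables among n de Bruijn indices;
-- ∃′ binds index zero.
data Formula {ℓ : Level} (L : Language ℓ) : ℕ → Set ℓ where
  _≐_  : ∀ {n} → Term L n → Term L n → Formula L n
  pred : ∀ {n k} → Predicate L k → Vec (Term L n) k → Formula L n
  ⊤′   : ∀ {n} → Formula L n
  ¬′_  : ∀ {n} → Formula L n → Formula L n
  _∧′_ : ∀ {n} → Formula L n → Formula L n → Formula L n
  ∃′   : ∀ {n} → Formula L (suc n) → Formula L n

module _ {ℓ : Level} {L : Language ℓ} where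

  infixr 5 _⇒′_
  infix  4 _⇔′_

  -- The remaining connectives are the usual classical abbreviations.

  _⇒′_ : ∀ {n} → Formula L n → Formula L n → Formula L n
  φ ⇒′ ψ = ¬′ (φ ∧′ ¬′ ψ)

  _⇔′_ : ∀ {n} → Formula L n → Formula L n → Formula L n
  φ ⇔′ ψ = (φ ⇒′ ψ) ∧′ (ψ ⇒′ φ)

  ∀′ : ∀ {n} → Formula L (suc n) → Formula L n
  ∀′ φ = ¬′ ∃′ (¬′ φ)

  ⋀ : ∀ {n k} → Vec (Formula L n) k → Formula L n
  ⋀ = foldr′ _∧′_ ⊤′

  -- Quantification over the first k of the k + n variables.
  ∃ⁿ : ∀ k {n} → Formula L (k + n) → Formula L n
  ∃ⁿ zero    φ = φ
  ∃ⁿ (suc k) φ = ∃ⁿ k (∃′ φ)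

  ∀∗ : ∀ {n} → Formula L n → Formula L 0
  ∀∗ {zero}  φ = φ
  ∀∗ {suc n} φ = ∀∗ (∀′ φ)

  weaken : ∀ k {n} → Term L n → Term L (k + n)
  weaken k (var x) = var (k ↑ʳ x)
  weaken k (con c) = con c

  -- The variables of an argument list, provided no constant occurs in it.
  variables : ∀ {n k} → Vec (Term L n) k → Maybe (Vec (Fin n) k)
  variables []           = just []
  variables (con c ∷ ts) = nothing
  variables (var x ∷ ts) with variables ts
  ... | just xs = just (x ∷ xs)
  ... | nothing = nothing

Theory : {ℓ : Level} → Language ℓ → Set (lsuc ℓ)
Theory {ℓ} L = Pred (Formula L 0) ℓ

-- The domain is a setoid, whose equality interprets the equality symbol;
-- since quotient types are unavailable, this plays the role of a set.
record Structure {ℓ : Level} (L : Language ℓ) : Set (lsuc ℓ) where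
  field
    domain : Setoid ℓ ℓ

  open Setoid domain public using (Carrier; _≈_)

  field
    ⟦con⟧     : Constant L → Carrier
    ⟦pred⟧    : ∀ {k} → Predicate L k → Vec Carrier k → Set ℓ
    pred-resp : ∀ {k} (R : Predicate L k) {xs ys : Vec Carrier k} →
                Pointwise _≈_ xs ys → ⟦pred⟧ R xs → ⟦pred⟧ R ys

open Structure public using (Carrier)

module _ {ℓ : Level} {L : Language ℓ} (M : Structure L) where
  private module M = Structure M

  eval : ∀ {n} → Vec (Carrier M) n → Term L n → Carrier M
  eval ρ (var x) = lookup ρ x
  eval ρ (con c) = M.⟦con⟧ c

  infix 3 _⊨_[_]

  _⊨_[_] : ∀ {n} → Formula L n → Vec (Carrier M) n → Set ℓ
  _⊨_[_] (s ≐ t)     ρ = eval ρ s M.≈ eval ρ t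
  _⊨_[_] (pred R ts) ρ = M.⟦pred⟧ R (map (eval ρ) ts)
  _⊨_[_] ⊤′          ρ = ⊤
  _⊨_[_] (¬′ φ)      ρ = ¬ (_⊨_[_] φ ρ)
  _⊨_[_] (φ ∧′ ψ)    ρ = _⊨_[_] φ ρ × _⊨_[_] ψ ρ
  _⊨_[_] (∃′ φ)      ρ = Σ (Carrier M) λ x → _⊨_[_] φ (x ∷ ρ)

  IsModel : Theory L → Set ℓ
  IsModel T = ∀ σ → T σ → _⊨_[_] σ []

Satisfiable : {ℓ : Level} {L : Language ℓ} → Theory L → Set (lsuc ℓ)
Satisfiable {L = L} T = Σ (Structure L) λ M → IsModel M T

------------------------------------------------------------------------
-- Indiscernible sequences and distality

-- A formula over A is a formula φ with its last k variables replaced by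
-- elements bs of A.  The terms of the sequence are m-tuples.
Indiscernible : {ℓ : Level} {L : Language ℓ} (M : Structure L) (A : Pred (Carrier M) ℓ)
                {m : ℕ} {I : Set ℓ} (_<_ : Rel I ℓ) (a : I → Vec (Carrier M) m) → Set ℓ
Indiscernible {L = L} M A {m} {I} _<_ a =
  ∀ {n} (is js : Vec I n) → Linked _<_ is → Linked _<_ js →
  ∀ {k} (φ : Formula L (n * m + k)) (bs : Vec (Carrier M) k) → All A bs →
  (M ⊨ φ [ concat (map a is) ++ bs ]) ⇔ (M ⊨ φ [ concat (map a js) ++ bs ])

record IsInfiniteOrderWithoutEndpoints {ℓ : Level} {I : Set ℓ} (_<_ : Rel I ℓ) : Set ℓ where
  field
    isStrictTotalOrder : IsStrictTotalOrder _≡_ _<_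
    infinite           : ¬ (∃ λ n → I ↔ Fin n)
    noLeast            : ∀ i → ∃ λ j → j < i
    noGreatest         : ∀ i → ∃ λ j → i < j

module _ {ℓ : Level} {I₁ I₂ : Set ℓ} (_<₁_ : Rel I₁ ℓ) (_<₂_ : Rel I₂ ℓ) where

  -- The orders I₁ + (c) + I₂ and I₁ + I₂; c is inj₂ (inj₁ tt).

  _<ᶜ_ : Rel (I₁ ⊎ Unit ⊎ I₂) ℓ
  _<ᶜ_ = _<₁_ ⊎-< ((λ _ _ → ⊥) ⊎-< _<₂_)

  _<⁺_ : Rel (I₁ ⊎ I₂) ℓ
  _<⁺_ = _<₁_ ⊎-< _<₂_

omit-c : {ℓ : Level} {I₁ I₂ : Set ℓ} → I₁ ⊎ I₂ → I₁ ⊎ Unit ⊎ I₂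
omit-c (inj₁ i) = inj₁ i
omit-c (inj₂ i) = inj₂ (inj₂ i)

-- T need not be complete, and the monster model is only a device for
-- treating parameter sets and sequences from all models of T uniformly:
-- every configuration in a model of T embeds elementarily in a monster
-- model of T.  Hence M ranges over all models of T.
Distal : {ℓ : Level} {L : Language ℓ} → Theory L → Set (lsuc ℓ)
Distal {ℓ} {L} T =
  (M : Structure L) → IsModel M T →
  (A : Pred (Carrier M) ℓ)
  {I₁ I₂ : Set ℓ} (_<₁_ : Rel I₁ ℓ) (_<₂_ : Rel I₂ ℓ) →
  IsInfiniteOrderWithoutEndpoints _<₁_ → IsInfiniteOrderWithoutEndpoints _<₂_ →
  {m : ℕ} (a : I₁ ⊎ Unit ⊎ I₂ → Vec (Carrier M) m) →
  Indiscernible M ∅ (_<ᶜ_ _<₁_ _<₂_) a →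
  Indiscernible M A (_<⁺_ _<₁_ _<₂_) (a ∘ omit-c) →
  Indiscernible M A (_<ᶜ_ _<₁_ _<₂_) a

------------------------------------------------------------------------
-- Simple products

-- Tagging with from₁ and from₂ makes the two languages disjoint.
data SimPredicate {ℓ : Level} (L₁ L₂ : Language ℓ) : ℕ → Set ℓ where
  from₁ : ∀ {k} → Predicate L₁ k → SimPredicate L₁ L₂ k
  from₂ : ∀ {k} → Predicate L₂ k → SimPredicate L₁ L₂ k
  ∼₁ ∼₂ : SimPredicate L₁ L₂ 2

Lsim : {ℓ : Level} → Language ℓ → Language ℓ → Language ℓ
Lsim L₁ L₂ = record
  { Constant  = Constant L₁ × Constant L₂
  ; Predicate = SimPredicate L₁ L₂
  }

module StandardConversion
  {ℓ : Level} {L L′ : Language ℓ}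
  (embed : ∀ {k} → Predicate L k → Predicate L′ k)
  (∼ : Predicate L′ 2)
  (C : Constant L → Constant L′)
  where

  convertTerm : ∀ {n} → Term L n → Term L′ n
  convertTerm (var x) = var x
  convertTerm (con c) = con (C c)

  convertEq : ∀ {n} → Term L n → Term L n → Formula L′ n
  convertEq s t = pred ∼ (convertTerm s ∷ convertTerm t ∷ [])

  -- R(t̄) is left unchanged when no constant occurs in t̄; otherwise it is
  -- first rewritten as ∃ȳ (R(ȳ) ∧ ⋀ᵢ tᵢ = yᵢ).
  convertPred : ∀ {n k} → Predicate L k → Vec (Term L n) k → Formula L′ n
  convertPred {n} {k} R ts with variables ts
  ... | just xs = pred (embed R) (map var xs)
  ... | nothing = ∃ⁿ k (pred (embed R) (map convertTerm ys)
                        ∧′ ⋀ (zipWith convertEq (map (weaken k) ts) ys))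
    where
    ys : Vec (Term L (k + n)) k
    ys = map (λ i → var (i ↑ˡ n)) (allFin k)

  convert : ∀ {n} → Formula L n → Formula L′ n
  convert (s ≐ t)     = convertEq s t
  convert (pred R ts) = convertPred R ts
  convert ⊤′          = ⊤′
  convert (¬′ φ)      = ¬′ convert φ
  convert (φ ∧′ ψ)    = convert φ ∧′ convert ψ
  convert (∃′ φ)      = ∃′ (convert φ)

module _ {ℓ : Level} {L : Language ℓ} where

  ⟨_,_⟩∈_ : ∀ {n} → Fin n → Fin n → Predicate L 2 → Formula L n
  ⟨ x , y ⟩∈ ∼ = pred ∼ (var x ∷ var y ∷ [])

  reflexivity symmetry transitivity : Predicate L 2 → Formula L 0
  reflexivity  ∼ = ∀∗ {n = 1} (⟨ zero , zero ⟩∈ ∼)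
  symmetry     ∼ = ∀∗ {n = 2} (⟨ suc zero , zero ⟩∈ ∼ ⇒′ ⟨ zero , suc zero ⟩∈ ∼)
  transitivity ∼ = ∀∗ {n = 3} (⟨ suc (suc zero) , suc zero ⟩∈ ∼ ∧′ ⟨ suc zero , zero ⟩∈ ∼
                               ⇒′ ⟨ suc (suc zero) , zero ⟩∈ ∼)

  -- ∀x̄ ∀ȳ (x̄ ∼ ȳ → (R(x̄) ↔ R(ȳ)))
  congruence : ∀ {k} → Predicate L 2 → Predicate L k → Formula L 0
  congruence {k} ∼ R = ∀∗ (⋀ (zipWith (λ x y → ⟨ x , y ⟩∈ ∼) xs ys)
                           ⇒′ (pred R (map var xs) ⇔′ pred R (map var ys)))
    where
    xs ys : Vec (Fin (k + k)) k
    xs = map (_↑ˡ k) (allFin k)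
    ys = map (k ↑ʳ_) (allFin k)

module _ {ℓ : Level} {L₁ L₂ : Language ℓ} where

  data T× : Theory (Lsim L₁ L₂) where
    refl₁  : T× (reflexivity ∼₁)
    sym₁   : T× (symmetry ∼₁)
    trans₁ : T× (transitivity ∼₁)
    refl₂  : T× (reflexivity ∼₂)
    sym₂   : T× (symmetry ∼₂)
    trans₂ : T× (transitivity ∼₂)
    -- ∀x ∀y (x ∼₁ y ∧ x ∼₂ y → x = y)
    unique : T× (∀∗ {n = 2} (⟨ suc zero , zero ⟩∈ ∼₁ ∧′ ⟨ suc zero , zero ⟩∈ ∼₂
                             ⇒′ var (suc zero) ≐ var zero))
    -- ∀x ∀y ∃z (x ∼₁ z ∧ y ∼₂ z)
    pair   : T× (∀∗ {n = 2} (∃′ (⟨ suc (suc zero) , zero ⟩∈ ∼₁ ∧′ ⟨ suc zero , zero ⟩∈ ∼₂)))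

  -- d₁ and d₂ are the fixed constants used in the standard conversions.
  module _ (d₁ : Constant L₁) (d₂ : Constant L₂) where

    module Conversion₁ =
      StandardConversion {L = L₁} {L′ = Lsim L₁ L₂} from₁ ∼₁ (λ c → c , d₂)
    module Conversion₂ =
      StandardConversion {L = L₂} {L′ = Lsim L₁ L₂} from₂ ∼₂ (λ c → d₁ , c)

    data Tsim (T₁ : Theory L₁) (T₂ : Theory L₂) : Theory (Lsim L₁ L₂) where
      product : ∀ {σ} → T× σ → Tsim T₁ T₂ σ
      axiom₁  : ∀ {σ} → T₁ σ → Tsim T₁ T₂ (Conversion₁.convert σ)
      axiom₂  : ∀ {σ} → T₂ σ → Tsim T₁ T₂ (Conversion₂.convert σ)
      cong₁   : ∀ {k} (R : Predicate L₁ k) → Tsim T₁ T₂ (congruence ∼₁ (from₁ R))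
      cong₂   : ∀ {k} (R : Predicate L₂ k) → Tsim T₁ T₂ (congruence ∼₂ (from₂ R))

{-# OPTIONS --safe #-}

-- A model M of the theory of simple products is, up to the names of its constants, a product
-- of N₁ = M/∼₁ and N₂ = M/∼₂.  In the Feferman–Vaught style, every formula without constants
-- is equivalent in M to a finite disjunction of conjunctions φ(x̄₁) ∧ ψ(x̄₂), where φ speaks
-- about the projections to N₁ and ψ about those to N₂; the existential quantifier distributes
-- over such conjunctions because every pair of classes has a common element.  Hence a sequence
-- in M is A-indiscernible as soon as its projections are indiscernible over the projections of
-- A and of the constants, and the constants may always be added to the parameter set.  The
-- standard conversion gives the reverse implication.  For distality of a factor, a sequence in
-- N₁ is embedded in N₁ × N₂ with a constant second coordinate.

module Submission where

open import Axiom.ExcludedMiddle using (ExcludedMiddle)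
open import Data.Empty.Polymorphic using (⊥; ⊥-elim)
open import Data.Fin using (Fin; zero; suc; _↑ˡ_; _↑ʳ_)
open import Data.List using (List; _∷_; []; [_]; length)
  renaming (_++_ to _++ᴸ_; map to mapᴸ; cartesianProductWith to productWith)
open import Data.List.Membership.Propositional using (_∈_)
open import Data.List.Membership.Propositional.Properties using (∈-++⁺ˡ; ∈-++⁺ʳ)
open import Data.List.Relation.Unary.Any as Any using (Any; here; there; index)
import Data.List.Relation.Unary.Any.Properties as Any
open import Data.Maybe using (just; nothing)
open import Data.Nat using (ℕ; zero; suc; _+_; _*_)
open import Data.Product as Product using (Σ; ∃; ∃₂; _×_; _,_; proj₁; proj₂)
open import Data.Product.Function.NonDependent.Propositional using (_×-⇔_)
open import Data.Product.Relation.Binary.Pointwise.NonDependent using (×-setoid)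
open import Data.Sum using (_⊎_; inj₁; inj₂)
open import Data.Unit.Polymorphic using (⊤; tt)
open import Data.Vec using (Vec; []; _∷_; _++_; allFin; concat; fromList; lookup; map; replicate; zipWith)
import Data.Vec.Properties as Vec
open import Data.Vec.Relation.Binary.Pointwise.Inductive as Pointwise using (Pointwise; []; _∷_)
open import Data.Vec.Relation.Unary.All as All using (All; []; _∷_)
import Data.Vec.Relation.Unary.All.Properties as All
open import Function using (_∘_; id; _⇔_; mk⇔; Equivalence)
import Function.Properties.Equivalence as ⇔
open import Function.Related.TypeIsomorphisms using (¬-cong-⇔)
open import Level using (Level)
open import Relation.Binary using (Rel; Setoid)
open import Relation.Binary.PropositionalEquality as ≡ using (_≡_; refl; sym; trans; cong; subst; module ≡-Reasoning)
open import Relation.Nullary using (¬_; yes; no)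
open import Relation.Nullary.Decidable using (decidable-stable)
open import Relation.Unary using (Pred; _∪_)
open import Relation.Unary.Polymorphic using (∅)
open import Defs

open Equivalence using (to; from)

private
  variable
    ℓ : Level
    A B : Set ℓ
    k m n : ℕ
    L L′ L₁ L₂ : Language ℓ

-- Equivalences, vectors and classical implication.

≡⇒⇔ : (P : A → Set ℓ) {x y : A} → x ≡ y → P x ⇔ P y
≡⇒⇔ P refl = ⇔.refl

≡⇒⇔₂ : (_∼_ : A → B → Set ℓ) {x x′ : A} {y y′ : B} → x ≡ x′ → y ≡ y′ → (x ∼ y) ⇔ (x′ ∼ y′)
≡⇒⇔₂ _∼_ refl refl = ⇔.refl

∃-cong-⇔ : {P Q : A → Set ℓ} → (∀ x → P x ⇔ Q x) → ∃ P ⇔ ∃ Q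
∃-cong-⇔ P⇔Q = mk⇔ (λ (x , p) → x , to (P⇔Q x) p) (λ (x , q) → x , from (P⇔Q x) q)

Pointwise-map-⇔ : {C : Set ℓ} {_∼_ : Rel C ℓ} (f : A → C) (g : B → C)
                  (xs : Vec A n) (ys : Vec B n) →
                  Pointwise (λ x y → f x ∼ g y) xs ys ⇔ Pointwise _∼_ (map f xs) (map g ys)
Pointwise-map-⇔ f g []       []       = mk⇔ (λ _ → []) (λ _ → [])
Pointwise-map-⇔ f g (x ∷ xs) (y ∷ ys) = mk⇔
  (λ { (r ∷ rs) → r ∷ to (Pointwise-map-⇔ f g xs ys) rs })
  (λ { (r ∷ rs) → r ∷ from (Pointwise-map-⇔ f g xs ys) rs })

map-section : {f : A → B} {g : B → A} → (∀ y → f (g y) ≡ y) → (ys : Vec B n) → map f (map g ys) ≡ ys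
map-section {f = f} {g} f∘g≗id ys =
  trans (sym (Vec.map-∘ f g ys)) (trans (Vec.map-cong f∘g≗id ys) (Vec.map-id ys))

lookup-index : {xs : List A} {x : A} (x∈xs : x ∈ xs) → lookup (fromList xs) (index x∈xs) ≡ x
lookup-index (here refl)  = refl
lookup-index (there x∈xs) = lookup-index x∈xs

⇒-elim : ExcludedMiddle ℓ → {P Q : Set ℓ} → ¬ (P × ¬ Q) → P → Q
⇒-elim em ¬[p×¬q] p = decidable-stable em λ ¬q → ¬[p×¬q] (p , ¬q)

-- Semantics of formulas

module _ {L : Language ℓ} (M : Structure L) where
  private module M = Structure M

  open Setoid M.domain using () renaming (refl to ≈-refl; sym to ≈-sym; trans to ≈-trans)

  eval-resp : {ρ ρ′ : Vec (Carrier M) n} → Pointwise M._≈_ ρ ρ′ → ∀ t → eval M ρ t M.≈ eval M ρ′ t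
  eval-resp ρ≈ρ′ (var x) = Pointwise.lookup ρ≈ρ′ x
  eval-resp ρ≈ρ′ (con c) = ≈-refl

  ⊨-resp : (φ : Formula L n) {ρ ρ′ : Vec (Carrier M) n} → Pointwise M._≈_ ρ ρ′ →
           (M ⊨ φ [ ρ ]) ⇔ (M ⊨ φ [ ρ′ ])
  ⊨-resp (s ≐ t) ρ≈ρ′ = mk⇔
    (λ s≈t → ≈-trans (≈-sym (eval-resp ρ≈ρ′ s)) (≈-trans s≈t (eval-resp ρ≈ρ′ t)))
    (λ s≈t → ≈-trans (eval-resp ρ≈ρ′ s) (≈-trans s≈t (≈-sym (eval-resp ρ≈ρ′ t))))
  ⊨-resp (pred R ts) ρ≈ρ′ = mk⇔ (M.pred-resp R evals) (M.pred-resp R (Pointwise.sym ≈-sym evals))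
    where
    evals = to (Pointwise-map-⇔ _ _ ts ts) (Pointwise.refl (λ {t} → eval-resp ρ≈ρ′ t))
  ⊨-resp ⊤′ ρ≈ρ′ = ⇔.refl
  ⊨-resp (¬′ φ) ρ≈ρ′ = ¬-cong-⇔ (⊨-resp φ ρ≈ρ′)
  ⊨-resp (φ ∧′ ψ) ρ≈ρ′ = ⊨-resp φ ρ≈ρ′ ×-⇔ ⊨-resp ψ ρ≈ρ′
  ⊨-resp (∃′ φ) ρ≈ρ′ = ∃-cong-⇔ λ x → ⊨-resp φ (≈-refl ∷ ρ≈ρ′)

  ⊨-subst : (φ : Formula L n) {ρ ρ′ : Vec (Carrier M) n} → ρ ≡ ρ′ → (M ⊨ φ [ ρ ]) ⇔ (M ⊨ φ [ ρ′ ])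
  ⊨-subst φ = ≡⇒⇔ (M ⊨ φ [_])

  ⊨-∃ⁿ : ∀ k (φ : Formula L (k + n)) (ρ : Vec (Carrier M) n) →
         (M ⊨ ∃ⁿ k φ [ ρ ]) ⇔ (∃ λ (xs : Vec (Carrier M) k) → M ⊨ φ [ xs ++ ρ ])
  ⊨-∃ⁿ zero φ ρ = mk⇔ ([] ,_) λ { ([] , p) → p }
  ⊨-∃ⁿ (suc k) φ ρ = ⇔.trans (⊨-∃ⁿ k (∃′ φ) ρ)
    (mk⇔ (λ (xs , x , p) → x ∷ xs , p) (λ { (x ∷ xs , p) → xs , x , p }))

  ⊨-⋀-zipWith : (f : A → B → Formula L n) (xs : Vec A k) (ys : Vec B k) (ρ : Vec (Carrier M) n) →
                (M ⊨ ⋀ (zipWith f xs ys) [ ρ ]) ⇔ Pointwise (λ x y → M ⊨ f x y [ ρ ]) xs ys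
  ⊨-⋀-zipWith f []       []       ρ = mk⇔ (λ _ → []) (λ _ → tt)
  ⊨-⋀-zipWith f (x ∷ xs) (y ∷ ys) ρ = mk⇔
    (λ (p , ps) → p ∷ to (⊨-⋀-zipWith f xs ys ρ) ps)
    (λ { (p ∷ ps) → p , from (⊨-⋀-zipWith f xs ys ρ) ps })

  eval-weaken : ∀ {k} (xs : Vec (Carrier M) k) (ρ : Vec (Carrier M) n) t →
                eval M (xs ++ ρ) (weaken k t) ≡ eval M ρ t
  eval-weaken xs ρ (var x) = Vec.lookup-++ʳ xs ρ x
  eval-weaken xs ρ (con c) = refl

  ⊨-∀∗⁺ : (φ : Formula L n) → (∀ ρ → M ⊨ φ [ ρ ]) → M ⊨ ∀∗ φ [ [] ]
  ⊨-∀∗⁺ {zero}  φ p = p []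
  ⊨-∀∗⁺ {suc n} φ p = ⊨-∀∗⁺ (∀′ φ) λ { ρ (x , ¬q) → ¬q (p (x ∷ ρ)) }

  -- Since `∀′` abbreviates `¬′ ∃′ ¬′`, instantiating a universal sentence needs double negation
  -- elimination; the converse `⊨-∀∗⁺` is constructive.
  ⊨-∀∗⁻ : ExcludedMiddle ℓ → (φ : Formula L n) → M ⊨ ∀∗ φ [ [] ] → ∀ ρ → M ⊨ φ [ ρ ]
  ⊨-∀∗⁻ {zero}  em φ p []      = p
  ⊨-∀∗⁻ {suc n} em φ p (x ∷ ρ) = decidable-stable em λ ¬q → ⊨-∀∗⁻ em (∀′ φ) p ρ (x , ¬q)

-- Substituting terms for variables and constants

-- Two instances matter: `D = Constant L` gives back `L`, and `D = ⊥` gives the language without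
-- constants.
replaceConstants : (L : Language ℓ) → Set ℓ → Language ℓ
replaceConstants L D = record { Constant = D ; Predicate = Predicate L }

reinterpret : {D : Set ℓ} (M : Structure L) → (D → Carrier M) → Structure (replaceConstants L D)
reinterpret M f = record
  { domain = M.domain ; ⟦con⟧ = f ; ⟦pred⟧ = M.⟦pred⟧ ; pred-resp = M.pred-resp }
  where module M = Structure M

constantₜ : Term L n → List (Constant L)
constantₜ (var x) = []
constantₜ (con c) = [ c ]

constantsₜ : Vec (Term L n) k → List (Constant L)
constantsₜ []       = []
constantsₜ (t ∷ ts) = constantₜ t ++ᴸ constantsₜ ts

constants : Formula L n → List (Constant L)
constants (s ≐ t)     = constantₜ s ++ᴸ constantₜ t
constants (pred R ts) = constantsₜ ts
constants ⊤′          = []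
constants (¬′ φ)      = constants φ
constants (φ ∧′ ψ)    = constants φ ++ᴸ constants ψ
constants (∃′ φ)      = constants φ

-- The case `k = 1` passes under a quantifier. With `k = n * m` the variables of the sequence stay
-- fixed, and only those of the parameters are substituted.
lift : (k : ℕ) → (Fin n → Term L m) → Fin (k + n) → Term L (k + m)
lift zero    σ x       = σ x
lift (suc k) σ zero    = var zero
lift (suc k) σ (suc x) = weaken 1 (lift k σ x)

module _ {L : Language ℓ} {D : Set ℓ} where

  substituteₜ : (t : Term L n) → (Fin n → Term (replaceConstants L D) m) →
                (∀ c → c ∈ constantₜ t → Term (replaceConstants L D) m) →
                Term (replaceConstants L D) m
  substituteₜ (var x) σ ι = σ x
  substituteₜ (con c) σ ι = ι c (here refl)

  substitutesₜ : (ts : Vec (Term L n) k) → (Fin n → Term (replaceConstants L D) m) →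
                 (∀ c → c ∈ constantsₜ ts → Term (replaceConstants L D) m) →
                 Vec (Term (replaceConstants L D) m) k
  substitutesₜ []       σ ι = []
  substitutesₜ (t ∷ ts) σ ι =
    substituteₜ t σ (λ c → ι c ∘ ∈-++⁺ˡ) ∷ substitutesₜ ts σ (λ c → ι c ∘ ∈-++⁺ʳ (constantₜ t))

  -- The map `ι` also receives the occurrence of the constant in `constants φ`, so that a constant
  -- can be sent to a variable numbered by its position in this finite list.
  substitute : (φ : Formula L n) → (Fin n → Term (replaceConstants L D) m) →
               (∀ c → c ∈ constants φ → Term (replaceConstants L D) m) →
               Formula (replaceConstants L D) m
  substitute (s ≐ t)     σ ι = substituteₜ s σ (λ c → ι c ∘ ∈-++⁺ˡ)
                               ≐ substituteₜ t σ (λ c → ι c ∘ ∈-++⁺ʳ (constantₜ s))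
  substitute (pred R ts) σ ι = pred R (substitutesₜ ts σ ι)
  substitute ⊤′          σ ι = ⊤′
  substitute (¬′ φ)      σ ι = ¬′ substitute φ σ ι
  substitute (φ ∧′ ψ)    σ ι = substitute φ σ (λ c → ι c ∘ ∈-++⁺ˡ)
                               ∧′ substitute ψ σ (λ c → ι c ∘ ∈-++⁺ʳ (constants φ))
  substitute (∃′ φ)      σ ι = ∃′ (substitute φ (lift 1 σ) (λ c → weaken 1 ∘ ι c))

  module _ (M : Structure L) (f : D → Carrier M) where
    private
      module M = Structure M
      M′ = reinterpret M f

    eval-lift : (k : ℕ) {σ : Fin n → Term (replaceConstants L D) m}
                {ρ : Vec (Carrier M) n} {ρ′ : Vec (Carrier M) m} →
                (∀ x → eval M′ ρ′ (σ x) ≡ lookup ρ x) →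
                (xs : Vec (Carrier M) k) → ∀ x → eval M′ (xs ++ ρ′) (lift k σ x) ≡ lookup (xs ++ ρ) x
    eval-lift zero    σ≡ []       x       = σ≡ x
    eval-lift (suc k) σ≡ (y ∷ xs) zero    = refl
    eval-lift (suc k) {σ} σ≡ (y ∷ xs) (suc x) =
      trans (eval-weaken M′ (y ∷ []) _ (lift k σ x)) (eval-lift k σ≡ xs x)

    module _ {ρ : Vec (Carrier M) n} {ρ′ : Vec (Carrier M) m}
             {σ : Fin n → Term (replaceConstants L D) m}
             (σ≡ : ∀ x → eval M′ ρ′ (σ x) ≡ lookup ρ x) where

      eval-substituteₜ : ∀ t {ι} → (∀ c c∈t → eval M′ ρ′ (ι c c∈t) ≡ M.⟦con⟧ c) →
                         eval M′ ρ′ (substituteₜ t σ ι) ≡ eval M ρ t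
      eval-substituteₜ (var x) ι≡ = σ≡ x
      eval-substituteₜ (con c) ι≡ = ι≡ c (here refl)

      eval-substitutesₜ : (ts : Vec (Term L n) k) → ∀ {ι} → (∀ c c∈ts → eval M′ ρ′ (ι c c∈ts) ≡ M.⟦con⟧ c) →
                          map (eval M′ ρ′) (substitutesₜ ts σ ι) ≡ map (eval M ρ) ts
      eval-substitutesₜ []       ι≡ = refl
      eval-substitutesₜ (t ∷ ts) ι≡ = ≡.cong₂ _∷_ (eval-substituteₜ t (λ c → ι≡ c ∘ ∈-++⁺ˡ))
                                                (eval-substitutesₜ ts (λ c → ι≡ c ∘ ∈-++⁺ʳ (constantₜ t)))

    ⊨-substitute : (φ : Formula L n) {ρ : Vec (Carrier M) n} {ρ′ : Vec (Carrier M) m}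
                   {σ : Fin n → Term (replaceConstants L D) m} →
                   (∀ x → eval M′ ρ′ (σ x) ≡ lookup ρ x) →
                   ∀ {ι} → (∀ c c∈φ → eval M′ ρ′ (ι c c∈φ) ≡ M.⟦con⟧ c) →
                   (M′ ⊨ substitute φ σ ι [ ρ′ ]) ⇔ (M ⊨ φ [ ρ ])
    ⊨-substitute (s ≐ t) σ≡ ι≡ = ≡⇒⇔₂ M._≈_
      (eval-substituteₜ σ≡ s (λ c → ι≡ c ∘ ∈-++⁺ˡ))
      (eval-substituteₜ σ≡ t (λ c → ι≡ c ∘ ∈-++⁺ʳ (constantₜ s)))
    ⊨-substitute (pred R ts) σ≡ ι≡ = ≡⇒⇔ (M.⟦pred⟧ R) (eval-substitutesₜ σ≡ ts ι≡)
    ⊨-substitute ⊤′ σ≡ ι≡ = ⇔.refl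
    ⊨-substitute (¬′ φ) σ≡ ι≡ = ¬-cong-⇔ (⊨-substitute φ σ≡ ι≡)
    ⊨-substitute (φ ∧′ ψ) σ≡ ι≡ =
      ⊨-substitute φ σ≡ (λ c → ι≡ c ∘ ∈-++⁺ˡ)
      ×-⇔ ⊨-substitute ψ σ≡ (λ c → ι≡ c ∘ ∈-++⁺ʳ (constants φ))
    ⊨-substitute (∃′ φ) σ≡ {ι} ι≡ = ∃-cong-⇔ λ x → ⊨-substitute φ
      (eval-lift 1 σ≡ (x ∷ []))
      (λ c c∈φ → trans (eval-weaken M′ (x ∷ []) _ (ι c c∈φ)) (ι≡ c c∈φ))

-- Indiscernibility over the constants

IsConstant : (M : Structure L) → Pred (Carrier M) _
IsConstant M x = ∃ λ c → Structure.⟦con⟧ M c ≡ x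

module _ {L : Language ℓ} (M : Structure L) (A : Pred (Carrier M) ℓ) where

  eliminateConstants : {bs : Vec (Carrier M) k} → All (A ∪ IsConstant M) bs →
                       Σ ℕ λ k′ → Σ (Vec (Carrier M) k′) λ bs′ → All A bs′ ×
                       Σ (Fin k → Term L k′) λ σ → ∀ x → eval M bs′ (σ x) ≡ lookup bs x
  eliminateConstants [] = zero , [] , [] , (λ ()) , λ ()
  eliminateConstants {bs = b ∷ bs} (b∈ ∷ bs∈) with eliminateConstants bs∈ | b∈
  ... | k′ , bs′ , bs′∈ , σ , σ≡ | inj₁ b∈A =
    suc k′ , b ∷ bs′ , b∈A ∷ bs′∈ , lift 1 σ , eval-lift M _ 1 σ≡ (b ∷ [])
  ... | k′ , bs′ , bs′∈ , σ , σ≡ | inj₂ (c , refl) =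
    k′ , bs′ , bs′∈ , (λ { zero → con c ; (suc x) → σ x }) , λ { zero → refl ; (suc x) → σ≡ x }

  module _ {I : Set ℓ} {_<_ : Rel I ℓ} {a : I → Vec (Carrier M) m} where

    -- A formula with parameters in `A ∪ IsConstant M` says the same as one over `A` in which some
    -- parameter variables have become constants, so the hypothesis applies to the latter.
    indiscernible-∪-constants : Indiscernible M A _<_ a → Indiscernible M (A ∪ IsConstant M) _<_ a
    indiscernible-∪-constants ind {n} is js <is <js φ bs bs∈ =
      let k′ , bs′ , bs′∈ , σ , σ≡ = eliminateConstants bs∈
          φ′ = substitute φ (lift (n * _) σ) (λ c _ → con c)
          φ′⇔φ : ∀ xs → (M ⊨ φ′ [ xs ++ bs′ ]) ⇔ (M ⊨ φ [ xs ++ bs ])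
          φ′⇔φ xs = ⊨-substitute M _ φ (eval-lift M _ (n * _) σ≡ xs) (λ _ _ → refl)
      in ⇔.trans (⇔.sym (φ′⇔φ _)) (⇔.trans (ind is js <is <js φ′ bs′ bs′∈) (φ′⇔φ _))

-- Standard conversion

module _ {L L′ : Language ℓ} (embed : ∀ {k} → Predicate L k → Predicate L′ k)
         (∼ : Predicate L′ 2) (C : Constant L → Constant L′) where

  open StandardConversion {L = L} {L′ = L′} embed ∼ C

  -- This presents `N` as the quotient of `M` by `∼`, with quotient map `π`. The map `section` is a
  -- right inverse up to `≡` and not just up to `≈`, so that environments can be rewritten along it.
  record Projection (M : Structure L′) (N : Structure L) : Set ℓ where
    private
      module M = Structure M
      module N = Structure N
    field
      π         : Carrier M → Carrier N
      section   : Carrier N → Carrier M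
      π-section : ∀ y → π (section y) ≡ y
      ∼-⇔       : ∀ x y → M.⟦pred⟧ ∼ (x ∷ y ∷ []) ⇔ π x N.≈ π y
      pred-⇔    : ∀ {k} (R : Predicate L k) xs → M.⟦pred⟧ (embed R) xs ⇔ N.⟦pred⟧ R (map π xs)
      π-con     : ∀ c → π (M.⟦con⟧ (C c)) ≡ N.⟦con⟧ c

  variables-just : (ts : Vec (Term L n) k) {xs : Vec (Fin n) k} → variables ts ≡ just xs → ts ≡ map var xs
  variables-just [] refl = refl
  variables-just (var x ∷ ts) eq with variables ts in eq′
  variables-just (var x ∷ ts) refl | just xs = cong (var x ∷_) (variables-just ts eq′)

  module _ {M : Structure L′} {N : Structure L} (p : Projection M N) where
    private
      module M = Structure M
      module N = Structure N
    open Projection p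
    open Setoid N.domain using () renaming (sym to ≈-sym; reflexive to ≈-reflexive)

    eval-convertTerm : (ρ : Vec (Carrier M) n) (t : Term L n) →
                       π (eval M ρ (convertTerm t)) ≡ eval N (map π ρ) t
    eval-convertTerm ρ (var x) = sym (Vec.lookup-map x π ρ)
    eval-convertTerm ρ (con c) = π-con c

    ⊨-convertEq : (s t : Term L n) (ρ : Vec (Carrier M) n) →
                  (M ⊨ convertEq s t [ ρ ]) ⇔ (N ⊨ s ≐ t [ map π ρ ])
    ⊨-convertEq s t ρ = ⇔.trans (∼-⇔ _ _) (≡⇒⇔₂ N._≈_ (eval-convertTerm ρ s) (eval-convertTerm ρ t))

    ⊨-pred-convertTerm : (R : Predicate L k) (ts : Vec (Term L n) k) (ρ : Vec (Carrier M) n) →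
                         (M ⊨ pred (embed R) (map convertTerm ts) [ ρ ]) ⇔ (N ⊨ pred R ts [ map π ρ ])
    ⊨-pred-convertTerm R ts ρ = ⇔.trans (pred-⇔ R _) (≡⇒⇔ (N.⟦pred⟧ R) (begin
      map π (map (eval M ρ) (map convertTerm ts)) ≡⟨ cong (map π) (Vec.map-∘ _ _ ts) ⟨
      map π (map (eval M ρ ∘ convertTerm) ts)     ≡⟨ Vec.map-∘ _ _ ts ⟨
      map (π ∘ eval M ρ ∘ convertTerm) ts         ≡⟨ Vec.map-cong (eval-convertTerm ρ) ts ⟩
      map (eval N (map π ρ)) ts                   ∎))
      where open ≡-Reasoning

    ⊨-convertPred : (R : Predicate L k) (ts : Vec (Term L n) k) (ρ : Vec (Carrier M) n) →
                    (M ⊨ convertPred R ts [ ρ ]) ⇔ (N ⊨ pred R ts [ map π ρ ])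
    ⊨-convertPred {k} {n} R ts ρ with variables ts in eq
    ... | just xs rewrite variables-just ts eq =
      subst (λ us → (M ⊨ pred (embed R) us [ ρ ]) ⇔ (N ⊨ pred R (map var xs) [ map π ρ ]))
            (sym (Vec.map-∘ convertTerm var xs)) (⊨-pred-convertTerm R (map var xs) ρ)
    ... | nothing = ⇔.trans (⊨-∃ⁿ M k _ ρ) (⇔.trans (∃-cong-⇔ body) (mk⇔
      (λ (zs , r , ts≈zs) → N.pred-resp R (Pointwise.sym ≈-sym ts≈zs) r)
      -- The witnesses for ȳ are sections of the values of the terms: they project back to exactly
      -- these values, so the equations hold by reflexivity.
      λ r → let eq = map-section π-section (map (eval N (map π ρ)) ts)
            in map section (map (eval N (map π ρ)) ts)
             , subst (N.⟦pred⟧ R) (sym eq) r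
             , subst (Pointwise N._≈_ _) (sym eq) (Pointwise.refl (≈-reflexive refl))))
      where
      open ≡-Reasoning
      ys : Vec (Term L (k + n)) k
      ys = map (λ i → var (i ↑ˡ n)) (allFin k)

      eval-ys : ∀ zs → map (eval N (map π (zs ++ ρ))) ys ≡ map π zs
      eval-ys zs = begin
        map (eval N (map π (zs ++ ρ))) ys                      ≡⟨ Vec.map-∘ _ _ (allFin k) ⟨
        map (λ i → lookup (map π (zs ++ ρ)) (i ↑ˡ n)) (allFin k)
          ≡⟨ Vec.map-cong (λ i → trans (Vec.lookup-map (i ↑ˡ n) π (zs ++ ρ))
                                       (cong π (Vec.lookup-++ˡ zs ρ i))) (allFin k) ⟩
        map (π ∘ lookup zs) (allFin k)                         ≡⟨ Vec.map-∘ _ _ (allFin k) ⟩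
        map π (map (lookup zs) (allFin k))                     ≡⟨ cong (map π) (Vec.map-lookup-allFin zs) ⟩
        map π zs                                               ∎

      eval-ts : ∀ zs → map (eval N (map π (zs ++ ρ))) (map (weaken k) ts) ≡ map (eval N (map π ρ)) ts
      eval-ts zs = trans (sym (Vec.map-∘ _ _ ts)) (Vec.map-cong
        (λ t → trans (cong (λ ρ′ → eval N ρ′ (weaken k t)) (Vec.map-++ π zs ρ))
                     (eval-weaken N (map π zs) (map π ρ) t)) ts)

      equations : ∀ zs → (M ⊨ ⋀ (zipWith convertEq (map (weaken k) ts) ys) [ zs ++ ρ ]) ⇔
                         Pointwise N._≈_ (map (eval N (map π ρ)) ts) (map π zs)
      equations zs = ⇔.trans (⊨-⋀-zipWith M convertEq (map (weaken k) ts) ys (zs ++ ρ)) (⇔.trans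
        (mk⇔ (Pointwise.map (λ {s} {t} → to (⊨-convertEq s t (zs ++ ρ))))
             (Pointwise.map (λ {s} {t} → from (⊨-convertEq s t (zs ++ ρ)))))
        (⇔.trans (Pointwise-map-⇔ _ _ (map (weaken k) ts) ys)
                 (≡⇒⇔₂ (Pointwise N._≈_) (eval-ts zs) (eval-ys zs))))

      body : ∀ zs → (M ⊨ pred (embed R) (map convertTerm ys)
                         ∧′ ⋀ (zipWith convertEq (map (weaken k) ts) ys) [ zs ++ ρ ]) ⇔
                    (N.⟦pred⟧ R (map π zs) × Pointwise N._≈_ (map (eval N (map π ρ)) ts) (map π zs))
      body zs = ⇔.trans (⊨-pred-convertTerm R ys (zs ++ ρ)) (≡⇒⇔ (N.⟦pred⟧ R) (eval-ys zs))
                ×-⇔ equations zs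

    -- Quantifiers over `M` and over `N` agree because `π` is onto: a witness in `N` is lifted by
    -- `section`.
    ⊨-convert : (φ : Formula L n) (ρ : Vec (Carrier M) n) →
                (M ⊨ convert φ [ ρ ]) ⇔ (N ⊨ φ [ map π ρ ])
    ⊨-convert (s ≐ t)     ρ = ⊨-convertEq s t ρ
    ⊨-convert (pred R ts) ρ = ⊨-convertPred R ts ρ
    ⊨-convert ⊤′          ρ = ⇔.refl
    ⊨-convert (¬′ φ)      ρ = ¬-cong-⇔ (⊨-convert φ ρ)
    ⊨-convert (φ ∧′ ψ)    ρ = ⊨-convert φ ρ ×-⇔ ⊨-convert ψ ρ
    ⊨-convert (∃′ φ)      ρ = mk⇔
      (λ (x , q) → π x , to (⊨-convert φ (x ∷ ρ)) q)
      (λ (y , q) → section y , from (⊨-convert φ (section y ∷ ρ))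
                                 (subst (λ y → N ⊨ φ [ y ∷ map π ρ ]) (sym (π-section y)) q))

    -- A formula over `B` is pulled back to `M` by the standard conversion, with each parameter
    -- replaced by its section; hence the condition that sections of elements of `B` lie in `A`.
    indiscernible-projection : {A : Pred (Carrier M) ℓ} {B : Pred (Carrier N) ℓ} → (∀ {y} → B y → A (section y)) →
                               {I : Set ℓ} {_<_ : Rel I ℓ} {a : I → Vec (Carrier M) m} {b : I → Vec (Carrier N) m} →
                               (∀ i → map π (a i) ≡ b i) → Indiscernible M A _<_ a → Indiscernible N B _<_ b
    indiscernible-projection B⊆A {a = a} {b} πa≡b ind is js <is <js φ bs bs∈B = ⇔.trans (⇔.sym (φ⇔ is))
      (⇔.trans (ind is js <is <js (convert φ) (map section bs) (All.map⁺ (All.map B⊆A bs∈B))) (φ⇔ js))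
      where
      open ≡-Reasoning
      φ⇔ : ∀ is → (M ⊨ convert φ [ concat (map a is) ++ map section bs ]) ⇔ (N ⊨ φ [ concat (map b is) ++ bs ])
      φ⇔ is = ⇔.trans (⊨-convert φ _) (⊨-subst N φ (begin
        map π (concat (map a is) ++ map section bs)           ≡⟨ Vec.map-++ π (concat (map a is)) _ ⟩
        map π (concat (map a is)) ++ map π (map section bs)
          ≡⟨ ≡.cong₂ _++_ (Vec.map-concat π (map a is)) (map-section π-section bs) ⟩
        concat (map (map π) (map a is)) ++ bs                 ≡⟨ cong (λ v → concat v ++ bs) (Vec.map-∘ _ _ is) ⟨
        concat (map (map π ∘ a) is) ++ bs                     ≡⟨ cong (λ v → concat v ++ bs) (Vec.map-cong πa≡b is) ⟩
        concat (map b is) ++ bs                               ∎))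

    -- Both `∼` and `R` on `M` are pulled back along `π`, so the axiom reduces to `pred-resp` in
    -- `N`.
    ⊨-congruence : (R : Predicate L k) → M ⊨ congruence ∼ (embed R) [ [] ]
    ⊨-congruence {k} R = ⊨-∀∗⁺ M body λ ρ (xs∼ys , ¬iff) → let eq = values ρ xs∼ys in ¬iff
      ( (λ (r , ¬r′) → ¬r′ (from (pred-⇔ R _) (N.pred-resp R eq (to (pred-⇔ R _) r))))
      , (λ (r , ¬r′) → ¬r′ (from (pred-⇔ R _) (N.pred-resp R (Pointwise.sym ≈-sym eq) (to (pred-⇔ R _) r)))))
      where
      xs ys : Vec (Fin (k + k)) k
      xs = map (_↑ˡ k) (allFin k)
      ys = map (k ↑ʳ_) (allFin k)

      body : Formula L′ (k + k)
      body = ⋀ (zipWith (λ x y → ⟨ x , y ⟩∈ ∼) xs ys)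
             ⇒′ (pred (embed R) (map var xs) ⇔′ pred (embed R) (map var ys))

      map-var : ∀ ρ zs → map (λ x → π (lookup ρ x)) zs ≡ map π (map (eval M ρ) (map var zs))
      map-var ρ zs = trans (Vec.map-∘ π (lookup ρ) zs) (cong (map π) (Vec.map-∘ (eval M ρ) var zs))

      values : ∀ ρ → M ⊨ ⋀ (zipWith (λ x y → ⟨ x , y ⟩∈ ∼) xs ys) [ ρ ] →
               Pointwise N._≈_ (map π (map (eval M ρ) (map var xs))) (map π (map (eval M ρ) (map var ys)))
      values ρ p = to (≡⇒⇔₂ (Pointwise N._≈_) (map-var ρ xs) (map-var ρ ys))
        (to (Pointwise-map-⇔ _ _ xs ys)
          (Pointwise.map (λ {x} {y} → to (∼-⇔ (lookup ρ x) (lookup ρ y))) (to (⊨-⋀-zipWith M _ xs ys ρ) p)))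

  -- A configuration in `N` is lifted by `section` to a model of `T′`, distality is applied there
  -- over the preimage of the parameter set, and the conclusion is projected back.
  distal-projection :
    {T : Theory L} {T′ : Theory L′} →
    (∀ N → IsModel N T → ∃₂ λ M (p : Projection M N) → IsModel M T′ ×
      (∀ {I : Set ℓ} {_<_ : Rel I ℓ} {m} {a : I → Vec (Carrier N) m} A →
       Indiscernible N A _<_ a →
       Indiscernible M (A ∘ Projection.π p) _<_ (map (Projection.section p) ∘ a))) →
    Distal T′ → Distal T
  distal-projection expand distal N N⊨T B _<₁_ _<₂_ order₁ order₂ a ind ind-B =
    let M , p , M⊨T′ , ind⇒ind = expand N N⊨T
        open Projection p
    in indiscernible-projection p (λ {y} → subst B (sym (π-section y))) (λ i → map-section π-section (a i))
         (distal M M⊨T′ (B ∘ π) _<₁_ _<₂_ order₁ order₂ (map section ∘ a) (ind⇒ind ∅ ind) (ind⇒ind B ind-B))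

  -- Quotients by a definable congruence.

  module Quotient
    (em : ExcludedMiddle ℓ) (M : Structure L′)
    (refl∼ : M ⊨ reflexivity ∼ [ [] ]) (sym∼ : M ⊨ symmetry ∼ [ [] ]) (trans∼ : M ⊨ transitivity ∼ [ [] ])
    (cong∼ : ∀ {k} (R : Predicate L k) → M ⊨ congruence ∼ (embed R) [ [] ]) where

    private
      module M = Structure M

      _≈_ : Rel (Carrier M) ℓ
      x ≈ y = M.⟦pred⟧ ∼ (x ∷ y ∷ [])

    -- This is the congruence axiom at the environment `us ++ vs`: the inner `⇒-elim` discharges the
    -- premise that the two halves are related, `proj₁` selects the forward implication, and the
    -- outer `⇒-elim` applies it.
    quotient-resp : (R : Predicate L k) {us vs : Vec (Carrier M) k} →
                    Pointwise _≈_ us vs → M.⟦pred⟧ (embed R) us → M.⟦pred⟧ (embed R) vs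
    quotient-resp {k} R {us} {vs} us≈vs r =
      subst (M.⟦pred⟧ (embed R)) (trans (sym (Vec.map-∘ (eval M ρ) var ys)) lookup-ys)
      (⇒-elim em (proj₁ (⇒-elim em
      (⊨-∀∗⁻ M em (⋀ (zipWith (λ x y → ⟨ x , y ⟩∈ ∼) xs ys)
              ⇒′ (pred (embed R) (map var xs) ⇔′ pred (embed R) (map var ys))) (cong∼ R) ρ)
      (from (⊨-⋀-zipWith M _ xs ys ρ)
        (from (Pointwise-map-⇔ (lookup ρ) (lookup ρ) xs ys)
          (from (≡⇒⇔₂ (Pointwise _≈_) lookup-xs lookup-ys) us≈vs)))))
      (subst (M.⟦pred⟧ (embed R)) (sym (trans (sym (Vec.map-∘ (eval M ρ) var xs)) lookup-xs)) r))
      where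
      ρ : Vec (Carrier M) (k + k)
      ρ = us ++ vs

      xs ys : Vec (Fin (k + k)) k
      xs = map (_↑ˡ k) (allFin k)
      ys = map (k ↑ʳ_) (allFin k)

      lookup-xs : map (lookup ρ) xs ≡ us
      lookup-xs = trans (sym (Vec.map-∘ _ _ (allFin k)))
        (trans (Vec.map-cong (Vec.lookup-++ˡ us vs) (allFin k)) (Vec.map-lookup-allFin us))

      lookup-ys : map (lookup ρ) ys ≡ vs
      lookup-ys = trans (sym (Vec.map-∘ _ _ (allFin k)))
        (trans (Vec.map-cong (Vec.lookup-++ʳ us vs) (allFin k)) (Vec.map-lookup-allFin vs))

    -- Domains are setoids, so the carrier is kept and `∼` becomes the equality; the projection and
    -- its section are then both the identity.
    quotient : Structure L
    quotient = record
      { domain = record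
        { Carrier = Carrier M
        ; _≈_ = _≈_
        ; isEquivalence = record
          { refl  = λ {x} → ⊨-∀∗⁻ M em (⟨ zero , zero ⟩∈ ∼) refl∼ (x ∷ [])
          -- Environments list the innermost variable first, so `x`, quantified first, comes last.
          ; sym   = λ {x} {y} → ⇒-elim em (⊨-∀∗⁻ M em (⟨ suc zero , zero ⟩∈ ∼ ⇒′ ⟨ zero , suc zero ⟩∈ ∼) sym∼ (y ∷ x ∷ []))
          ; trans = λ {x} {y} {z} x≈y y≈z → ⇒-elim em
              (⊨-∀∗⁻ M em (⟨ suc (suc zero) , suc zero ⟩∈ ∼ ∧′ ⟨ suc zero , zero ⟩∈ ∼
                      ⇒′ ⟨ suc (suc zero) , zero ⟩∈ ∼) trans∼ (z ∷ y ∷ x ∷ [])) (x≈y , y≈z)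
          }
        }
      ; ⟦con⟧ = M.⟦con⟧ ∘ C
      ; ⟦pred⟧ = λ R → M.⟦pred⟧ (embed R)
      ; pred-resp = quotient-resp
      }

    quotient-projection : Projection M quotient
    quotient-projection = record
      { π = id
      ; section = id
      ; π-section = λ _ → refl
      ; ∼-⇔ = λ _ _ → ⇔.refl
      ; pred-⇔ = λ R xs → ≡⇒⇔ (M.⟦pred⟧ (embed R)) (sym (Vec.map-id xs))
      ; π-con = λ _ → refl
      }

    indiscernible-quotient : (A : Pred (Carrier M) ℓ) {I : Set ℓ} {_<_ : Rel I ℓ} {a : I → Vec (Carrier M) m} →
                             Indiscernible M A _<_ a → Indiscernible quotient A _<_ a
    indiscernible-quotient A {a = a} =
      indiscernible-projection quotient-projection {A = A} id (Vec.map-id ∘ a)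

-- Feferman–Vaught decomposition

-- A list of pairs stands for the disjunction of the conjunctions φ(x̄₁) ∧ ψ(x̄₂), where
-- x̄₁ and x̄₂ are the projections of x̄.
Decomposition : (L₁ L₂ : Language ℓ) → ℕ → Set ℓ
Decomposition L₁ L₂ n = List (Formula L₁ n × Formula L₂ n)

-- The negation is a conjunction of disjunctions `¬φ ∨ ¬ψ`. Distributing yields one disjunct for
-- each choice, pair by pair, of the side that fails; the empty disjunction has the true complement.
complement : Decomposition L₁ L₂ n → Decomposition L₁ L₂ n
complement []            = [ ⊤′ , ⊤′ ]
complement ((φ , ψ) ∷ D) = mapᴸ (Product.map₁ (¬′ φ ∧′_)) (complement D)
                           ++ᴸ mapᴸ (Product.map₂ (¬′ ψ ∧′_)) (complement D)

_⊗_ : Decomposition L₁ L₂ n → Decomposition L₁ L₂ n → Decomposition L₁ L₂ n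
_⊗_ = productWith λ (φ , ψ) (φ′ , ψ′) → φ ∧′ φ′ , ψ ∧′ ψ′

variable-of : {P : ℕ → Set ℓ} → Term (record { Constant = ⊥ ; Predicate = P }) n → Fin n
variable-of (var x) = x

-- Constants are excluded because the conversions name only the projections of `(c , d₂)` to the
-- first factor and of `(d₁ , c)` to the second; other constant pairs may project to elements
-- without a name.
decompose : Formula (replaceConstants (Lsim L₁ L₂) ⊥) n → Decomposition L₁ L₂ n
decompose (s ≐ t) = [ var (variable-of s) ≐ var (variable-of t) , var (variable-of s) ≐ var (variable-of t) ]
decompose (pred (from₁ R) ts)        = [ pred R (map (var ∘ variable-of) ts) , ⊤′ ]
decompose (pred (from₂ R) ts)        = [ ⊤′ , pred R (map (var ∘ variable-of) ts) ]
decompose (pred ∼₁ (s ∷ t ∷ []))     = [ var (variable-of s) ≐ var (variable-of t) , ⊤′ ]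
decompose (pred ∼₂ (s ∷ t ∷ []))     = [ ⊤′ , var (variable-of s) ≐ var (variable-of t) ]
decompose ⊤′                         = [ ⊤′ , ⊤′ ]
decompose (¬′ φ)                     = complement (decompose φ)
decompose (φ ∧′ ψ)                   = decompose φ ⊗ decompose ψ
decompose (∃′ φ)                     = mapᴸ (Product.map ∃′ ∃′) (decompose φ)

singleton-⇔ : {P : A → Set ℓ} {x : A} → P x ⇔ Any P [ x ]
singleton-⇔ = mk⇔ here λ { (here p) → p ; (there ()) }

module _ {L₁ L₂ : Language ℓ} (N₁ : Structure L₁) (N₂ : Structure L₂) where

  Holds : Vec (Carrier N₁) n → Vec (Carrier N₂) n → Formula L₁ n × Formula L₂ n → Set ℓ
  Holds ρ₁ ρ₂ (φ , ψ) = (N₁ ⊨ φ [ ρ₁ ]) × (N₂ ⊨ ψ [ ρ₂ ])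

  ⊗-⇔ : {ρ₁ : Vec (Carrier N₁) n} {ρ₂ : Vec (Carrier N₂) n} (D E : Decomposition L₁ L₂ n) →
        (Any (Holds ρ₁ ρ₂) D × Any (Holds ρ₁ ρ₂) E) ⇔ Any (Holds ρ₁ ρ₂) (D ⊗ E)
  ⊗-⇔ D E = mk⇔
    (λ (d , e) → Any.cartesianProductWith⁺ _ (λ (p , q) (p′ , q′) → (p , p′) , (q , q′)) d e)
    (Any.cartesianProductWith⁻ _ (λ ((p , p′) , (q , q′)) → (p , q) , (p′ , q′)) D E)

  module _ (em : ExcludedMiddle ℓ) where

    -- Excluded middle decides whether `φ` of the first pair holds. If it does, `ψ` must fail, which
    -- selects the second half of `complement`; otherwise the first half applies.
    complement-⇔ : {ρ₁ : Vec (Carrier N₁) n} {ρ₂ : Vec (Carrier N₂) n} (D : Decomposition L₁ L₂ n) →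
                   (¬ Any (Holds ρ₁ ρ₂) D) ⇔ Any (Holds ρ₁ ρ₂) (complement D)
    complement-⇔ {n} {ρ₁} {ρ₂} D = mk⇔ (complement⁺ D) (complement⁻ D)
      where
      complement⁺ : ∀ D → ¬ Any (Holds ρ₁ ρ₂) D → Any (Holds ρ₁ ρ₂) (complement D)
      complement⁺ [] _ = here (tt , tt)
      complement⁺ ((φ , ψ) ∷ D) ¬d with em {P = N₁ ⊨ φ [ ρ₁ ]} | complement⁺ D (¬d ∘ there)
      ... | yes p | c = Any.++⁺ʳ (mapᴸ (Product.map₁ (¬′ φ ∧′_)) (complement D))
                          (Any.map⁺ (Any.map (λ (r , s) → r , (λ q → ¬d (here (p , q))) , s) c))
      ... | no ¬p | c = Any.++⁺ˡ (Any.map⁺ (Any.map (λ (r , s) → (¬p , r) , s) c))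

      complement⁻ : ∀ D → Any (Holds ρ₁ ρ₂) (complement D) → ¬ Any (Holds ρ₁ ρ₂) D
      complement⁻ ((φ , ψ) ∷ D) c d with Any.++⁻ (mapᴸ (Product.map₁ (¬′ φ ∧′_)) (complement D)) c | d
      ... | inj₁ c₁ | here (p , _) = proj₁ (proj₁ (proj₂ (Any.satisfied (Any.map⁻ c₁)))) p
      ... | inj₂ c₂ | here (_ , q) = proj₁ (proj₂ (proj₂ (Any.satisfied (Any.map⁻ c₂)))) q
      ... | inj₁ c₁ | there d′     = complement⁻ D (Any.map (λ ((_ , r) , s) → r , s) (Any.map⁻ c₁)) d′
      ... | inj₂ c₂ | there d′     = complement⁻ D (Any.map (λ (r , (_ , s)) → r , s) (Any.map⁻ c₂)) d′

-- Simple products of structures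

module _ {L₁ L₂ : Language ℓ} (d₁ : Constant L₁) (d₂ : Constant L₂) where

  -- Here `≈-⇔` says that the two projections are jointly injective, and `amalgam` that they are
  -- jointly onto. The latter holds only up to `≈`, which is what the axiom `pair` provides in the
  -- quotients.
  record SimpleProduct (M : Structure (Lsim L₁ L₂)) (N₁ : Structure L₁) (N₂ : Structure L₂) : Set ℓ where
    private
      module M  = Structure M
      module N₁ = Structure N₁
      module N₂ = Structure N₂
    field
      projection₁ : Projection from₁ ∼₁ (λ c → c , d₂) M N₁
      projection₂ : Projection from₂ ∼₂ (λ c → d₁ , c) M N₂
    open Projection projection₁ public using () renaming
      (π to π₁; section to section₁; π-section to π₁-section; ∼-⇔ to ∼₁-⇔; pred-⇔ to pred₁-⇔)
    open Projection projection₂ public using () renaming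
      (π to π₂; section to section₂; π-section to π₂-section; ∼-⇔ to ∼₂-⇔; pred-⇔ to pred₂-⇔)
    field
      ≈-⇔    : ∀ x y → x M.≈ y ⇔ (π₁ x N₁.≈ π₁ y × π₂ x N₂.≈ π₂ y)
      amalgam : ∀ y₁ y₂ → ∃ λ z → π₁ z N₁.≈ y₁ × π₂ z N₂.≈ y₂

  module _ (em : ExcludedMiddle ℓ) {M : Structure (Lsim L₁ L₂)} {N₁ : Structure L₁} {N₂ : Structure L₂}
           (S : SimpleProduct M N₁ N₂) where
    private
      module M  = Structure M
      module N₁ = Structure N₁
      module N₂ = Structure N₂
      M° = reinterpret M ⊥-elim
    open SimpleProduct S

    eval-variable-of : {N : Structure L} (π : Carrier M → Carrier N) (t : Term (replaceConstants (Lsim L₁ L₂) ⊥) n)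
                       (ρ : Vec (Carrier M) n) → π (eval M° ρ t) ≡ lookup (map π ρ) (variable-of t)
    eval-variable-of π (var x) ρ = sym (Vec.lookup-map x π ρ)

    eval-variables-of : {N : Structure L} (π : Carrier M → Carrier N)
                        (ts : Vec (Term (replaceConstants (Lsim L₁ L₂) ⊥) n) k) (ρ : Vec (Carrier M) n) →
                        map π (map (eval M° ρ) ts) ≡ map (eval N (map π ρ)) (map (var ∘ variable-of) ts)
    eval-variables-of {N = N} π ts ρ = begin
      map π (map (eval M° ρ) ts)                          ≡⟨ Vec.map-∘ _ _ ts ⟨
      map (π ∘ eval M° ρ) ts                              ≡⟨ Vec.map-cong (λ t → eval-variable-of {N = N} π t ρ) ts ⟩
      map (lookup (map π ρ) ∘ variable-of) ts             ≡⟨ Vec.map-∘ _ _ ts ⟩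
      map (eval N (map π ρ)) (map (var ∘ variable-of) ts) ∎
      where open ≡-Reasoning

    ⊨-decompose : (φ : Formula (replaceConstants (Lsim L₁ L₂) ⊥) n) (ρ : Vec (Carrier M) n) →
                  (M° ⊨ φ [ ρ ]) ⇔ Any (Holds N₁ N₂ (map π₁ ρ) (map π₂ ρ)) (decompose φ)
    ⊨-decompose (s ≐ t) ρ = ⇔.trans (≈-⇔ _ _) (⇔.trans
      (≡⇒⇔₂ N₁._≈_ (eval-variable-of {N = N₁} π₁ s ρ) (eval-variable-of {N = N₁} π₁ t ρ)
       ×-⇔ ≡⇒⇔₂ N₂._≈_ (eval-variable-of {N = N₂} π₂ s ρ) (eval-variable-of {N = N₂} π₂ t ρ)) singleton-⇔)
    ⊨-decompose (pred (from₁ R) ts) ρ = ⇔.trans (pred₁-⇔ R _) (⇔.trans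
      (≡⇒⇔ (N₁.⟦pred⟧ R) (eval-variables-of {N = N₁} π₁ ts ρ)) (⇔.trans (mk⇔ (_, tt) proj₁) singleton-⇔))
    ⊨-decompose (pred (from₂ R) ts) ρ = ⇔.trans (pred₂-⇔ R _) (⇔.trans
      (≡⇒⇔ (N₂.⟦pred⟧ R) (eval-variables-of {N = N₂} π₂ ts ρ)) (⇔.trans (mk⇔ (tt ,_) proj₂) singleton-⇔))
    ⊨-decompose (pred ∼₁ (s ∷ t ∷ [])) ρ = ⇔.trans (∼₁-⇔ _ _) (⇔.trans
      (≡⇒⇔₂ N₁._≈_ (eval-variable-of {N = N₁} π₁ s ρ) (eval-variable-of {N = N₁} π₁ t ρ))
      (⇔.trans (mk⇔ (_, tt) proj₁) singleton-⇔))
    ⊨-decompose (pred ∼₂ (s ∷ t ∷ [])) ρ = ⇔.trans (∼₂-⇔ _ _) (⇔.trans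
      (≡⇒⇔₂ N₂._≈_ (eval-variable-of {N = N₂} π₂ s ρ) (eval-variable-of {N = N₂} π₂ t ρ))
      (⇔.trans (mk⇔ (tt ,_) proj₂) singleton-⇔))
    ⊨-decompose ⊤′ ρ = mk⇔ (λ _ → here (tt , tt)) (λ _ → tt)
    ⊨-decompose (¬′ φ) ρ = ⇔.trans (¬-cong-⇔ (⊨-decompose φ ρ)) (complement-⇔ N₁ N₂ em (decompose φ))
    ⊨-decompose (φ ∧′ ψ) ρ =
      ⇔.trans (⊨-decompose φ ρ ×-⇔ ⊨-decompose ψ ρ) (⊗-⇔ N₁ N₂ (decompose φ) (decompose ψ))
    ⊨-decompose (∃′ φ) ρ = mk⇔
      (λ (x , p) → Any.map⁺ (Any.map (λ (q , r) → (π₁ x , q) , (π₂ x , r)) (to (⊨-decompose φ (x ∷ ρ)) p)))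
      -- The disjunct that holds gives a witness in each factor independently; `amalgam` merges them
      -- into one `z`, and `⊨-resp` absorbs the difference up to `≈`.
      (λ d → let y₁ , y₂ , d′ = common (decompose φ) (Any.map⁻ d)
                 z , z≈y₁ , z≈y₂ = amalgam y₁ y₂
                 refl₁ = Pointwise.refl (Setoid.refl N₁.domain)
                 refl₂ = Pointwise.refl (Setoid.refl N₂.domain)
             in z , from (⊨-decompose φ (z ∷ ρ))
                      (Any.map (λ {(χ , ω)} (p , q) → from (⊨-resp N₁ χ (z≈y₁ ∷ refl₁)) p
                                                     , from (⊨-resp N₂ ω (z≈y₂ ∷ refl₂)) q) d′))
      where
      common : ∀ D → Any (λ χω → Holds N₁ N₂ (map π₁ ρ) (map π₂ ρ) (Product.map ∃′ ∃′ χω)) D →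
               ∃₂ λ y₁ y₂ → Any (Holds N₁ N₂ (y₁ ∷ map π₁ ρ) (y₂ ∷ map π₂ ρ)) D
      common (_ ∷ _) (here ((y₁ , p) , (y₂ , q))) = y₁ , y₂ , here (p , q)
      common (_ ∷ D) (there d)                    = let y₁ , y₂ , d′ = common D d in y₁ , y₂ , there d′

    -- Once the constants of the formula have become parameters, the decomposition applies and each
    -- disjunct is transferred factor by factor. This is why `B₁` and `B₂` must contain the
    -- projections of the constants as well as those of `A`.
    indiscernible-product :
      {A : Pred (Carrier M) ℓ} {B₁ : Pred (Carrier N₁) ℓ} {B₂ : Pred (Carrier N₂) ℓ} →
      (∀ {x} → (A ∪ IsConstant M) x → B₁ (π₁ x)) → (∀ {x} → (A ∪ IsConstant M) x → B₂ (π₂ x)) →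
      {I : Set ℓ} {_<_ : Rel I ℓ} {a : I → Vec (Carrier M) m} →
      {b₁ : I → Vec (Carrier N₁) m} {b₂ : I → Vec (Carrier N₂) m} →
      (∀ i → map π₁ (a i) ≡ b₁ i) → (∀ i → map π₂ (a i) ≡ b₂ i) →
      Indiscernible N₁ B₁ _<_ b₁ → Indiscernible N₂ B₂ _<_ b₂ → Indiscernible M A _<_ a
    indiscernible-product {m = m} {A = A} A⊆B₁ A⊆B₂ {a = a} {b₁} {b₂} πa≡b₁ πa≡b₂ ind₁ ind₂
      {n} is js <is <js {k} φ bs bs∈A =
      ⇔.trans (⇔.sym (φ°⇔φ is)) (⇔.trans (⊨-decompose φ° (values is)) (⇔.trans (mk⇔
        (Any.map λ {(χ , ω)} → to (step χ ω)) (Any.map λ {(χ , ω)} → from (step χ ω)))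
        (⇔.trans (⇔.sym (⊨-decompose φ° (values js))) (φ°⇔φ js))))
      where
      cs : Vec (Constant (Lsim L₁ L₂)) (length (constants φ))
      cs = fromList (constants φ)

      ds : Vec (Carrier M) (k + length (constants φ))
      ds = bs ++ map M.⟦con⟧ cs

      ds∈ : All (A ∪ IsConstant M) ds
      ds∈ = All.++⁺ (All.map inj₁ bs∈A) (All.map⁺ (All.universal (λ c → inj₂ (c , refl)) cs))

      -- The variables are, in order, the `n * m` entries of the sequence, the `k` parameters, and
      -- one new variable for each occurrence of a constant in `φ`.
      φ° : Formula (replaceConstants (Lsim L₁ L₂) ⊥) (n * m + (k + length (constants φ)))
      φ° = substitute φ (lift (n * m) (λ x → var (x ↑ˡ _))) (λ c c∈φ → var (n * m ↑ʳ (k ↑ʳ index c∈φ)))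

      values : Vec _ n → Vec (Carrier M) (n * m + (k + length (constants φ)))
      values is = concat (map a is) ++ ds

      φ°⇔φ : ∀ is → (M° ⊨ φ° [ values is ]) ⇔ (M ⊨ φ [ concat (map a is) ++ bs ])
      φ°⇔φ is = ⊨-substitute M ⊥-elim φ
        (eval-lift M ⊥-elim (n * m) (Vec.lookup-++ˡ bs (map M.⟦con⟧ cs)) (concat (map a is)))
        λ c c∈φ → begin
          lookup (values is) (n * m ↑ʳ (k ↑ʳ index c∈φ)) ≡⟨ Vec.lookup-++ʳ (concat (map a is)) ds _ ⟩
          lookup ds (k ↑ʳ index c∈φ)                     ≡⟨ Vec.lookup-++ʳ bs _ (index c∈φ) ⟩
          lookup (map M.⟦con⟧ cs) (index c∈φ)            ≡⟨ Vec.lookup-map (index c∈φ) M.⟦con⟧ cs ⟩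
          M.⟦con⟧ (lookup cs (index c∈φ))                ≡⟨ cong M.⟦con⟧ (lookup-index c∈φ) ⟩
          M.⟦con⟧ c                                      ∎
        where open ≡-Reasoning

      project : {B : Set ℓ} (π : Carrier M → B) {b : _ → Vec B m} → (∀ i → map π (a i) ≡ b i) → ∀ is →
                map π (values is) ≡ concat (map b is) ++ map π ds
      project π πa≡b is = trans (Vec.map-++ π (concat (map a is)) ds) (cong (_++ map π ds)
        (trans (Vec.map-concat π (map a is))
          (cong concat (trans (sym (Vec.map-∘ (map π) a is)) (Vec.map-cong πa≡b is)))))

      step : ∀ χ ω → Holds N₁ N₂ (map π₁ (values is)) (map π₂ (values is)) (χ , ω) ⇔
                     Holds N₁ N₂ (map π₁ (values js)) (map π₂ (values js)) (χ , ω)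
      step χ ω =
        ⇔.trans (⊨-subst N₁ χ (project π₁ πa≡b₁ is)) (⇔.trans
          (ind₁ is js <is <js χ (map π₁ ds) (All.map⁺ (All.map A⊆B₁ ds∈)))
          (⇔.sym (⊨-subst N₁ χ (project π₁ πa≡b₁ js))))
        ×-⇔
        ⇔.trans (⊨-subst N₂ ω (project π₂ πa≡b₂ is)) (⇔.trans
          (ind₂ is js <is <js ω (map π₂ ds) (All.map⁺ (All.map A⊆B₂ ds∈)))
          (⇔.sym (⊨-subst N₂ ω (project π₂ πa≡b₂ js))))

-- The index tuples have the same length, so both environments consist of `n` copies of `v` followed
-- by `bs`.
constant-indiscernible : (M : Structure L) (A : Pred (Carrier M) ℓ) {I : Set ℓ} {_<_ : Rel I ℓ} (v : Vec (Carrier M) m) →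
                         Indiscernible M A _<_ (λ _ → v)
constant-indiscernible M A v is js _ _ φ bs _ = ⊨-subst M φ (cong (λ vs → concat vs ++ bs)
  (trans (Vec.map-const is v) (sym (Vec.map-const js v))))

-- The product of two given structures.

module _ {L₁ L₂ : Language ℓ} (d₁ : Constant L₁) (d₂ : Constant L₂) where

  module _ (N₁ : Structure L₁) (N₂ : Structure L₂) where
    private
      module N₁ = Structure N₁
      module N₂ = Structure N₂
      open Setoid N₁.domain using () renaming (refl to ≈₁-refl; sym to ≈₁-sym; trans to ≈₁-trans)
      open Setoid N₂.domain using () renaming (refl to ≈₂-refl; sym to ≈₂-sym; trans to ≈₂-trans)

    productPred : SimPredicate L₁ L₂ k → Vec (Carrier N₁ × Carrier N₂) k → Set ℓ
    productPred (from₁ R) xs       = N₁.⟦pred⟧ R (map proj₁ xs)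
    productPred (from₂ R) xs       = N₂.⟦pred⟧ R (map proj₂ xs)
    productPred ∼₁ (x ∷ y ∷ [])    = proj₁ x N₁.≈ proj₁ y
    productPred ∼₂ (x ∷ y ∷ [])    = proj₂ x N₂.≈ proj₂ y

    productPred-resp : (R : SimPredicate L₁ L₂ k) {xs ys : Vec (Carrier N₁ × Carrier N₂) k} →
                       Pointwise (Setoid._≈_ (×-setoid N₁.domain N₂.domain)) xs ys → productPred R xs → productPred R ys
    productPred-resp (from₁ R) xs≈ys = N₁.pred-resp R (Pointwise.map⁺ proj₁ xs≈ys)
    productPred-resp (from₂ R) xs≈ys = N₂.pred-resp R (Pointwise.map⁺ proj₂ xs≈ys)
    productPred-resp ∼₁ ((x≈x′ , _) ∷ (y≈y′ , _) ∷ []) x≈y = ≈₁-trans (≈₁-sym x≈x′) (≈₁-trans x≈y y≈y′)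
    productPred-resp ∼₂ ((_ , x≈x′) ∷ (_ , y≈y′) ∷ []) x≈y = ≈₂-trans (≈₂-sym x≈x′) (≈₂-trans x≈y y≈y′)

    productStructure : Structure (Lsim L₁ L₂)
    productStructure = record
      { domain    = ×-setoid N₁.domain N₂.domain
      ; ⟦con⟧     = Product.map N₁.⟦con⟧ N₂.⟦con⟧
      ; ⟦pred⟧    = productPred
      ; pred-resp = productPred-resp
      }

    productStructure-simple : SimpleProduct d₁ d₂ productStructure N₁ N₂
    productStructure-simple = record
      { projection₁ = record
        { π         = proj₁
        -- Freezing the second coordinate makes the lift of any sequence constant in `N₂`.
        ; section   = _, N₂.⟦con⟧ d₂
        ; π-section = λ _ → refl
        ; ∼-⇔       = λ _ _ → ⇔.refl
        ; pred-⇔    = λ _ _ → ⇔.refl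
        ; π-con     = λ _ → refl
        }
      ; projection₂ = record
        { π         = proj₂
        ; section   = N₁.⟦con⟧ d₁ ,_
        ; π-section = λ _ → refl
        ; ∼-⇔       = λ _ _ → ⇔.refl
        ; pred-⇔    = λ _ _ → ⇔.refl
        ; π-con     = λ _ → refl
        }
      ; ≈-⇔     = λ _ _ → ⇔.refl
      ; amalgam = λ y₁ y₂ → (y₁ , y₂) , ≈₁-refl , ≈₂-refl
      }

    open SimpleProduct productStructure-simple

    -- Each universal quantifier is a `¬′ ∃′ ¬′`, so every proof receives a supposed counterexample
    -- and refutes it one quantifier at a time.
    productStructure-⊨T× : IsModel productStructure T×
    productStructure-⊨T× _ refl₁ (_ , ¬p) = ¬p ≈₁-refl
    productStructure-⊨T× _ refl₂ (_ , ¬p) = ¬p ≈₂-refl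
    productStructure-⊨T× _ sym₁ (_ , ¬p) = ¬p λ (_ , ¬q) → ¬q λ (r , ¬s) → ¬s (≈₁-sym r)
    productStructure-⊨T× _ sym₂ (_ , ¬p) = ¬p λ (_ , ¬q) → ¬q λ (r , ¬s) → ¬s (≈₂-sym r)
    productStructure-⊨T× _ trans₁ (_ , ¬p) =
      ¬p λ (_ , ¬q) → ¬q λ (_ , ¬r) → ¬r λ ((s , t) , ¬u) → ¬u (≈₁-trans s t)
    productStructure-⊨T× _ trans₂ (_ , ¬p) =
      ¬p λ (_ , ¬q) → ¬q λ (_ , ¬r) → ¬r λ ((s , t) , ¬u) → ¬u (≈₂-trans s t)
    productStructure-⊨T× _ unique (_ , ¬p) = ¬p λ (_ , ¬q) → ¬q λ ((r , s) , ¬t) → ¬t (r , s)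
    productStructure-⊨T× _ pair (x , ¬p) = ¬p λ (y , ¬q) → ¬q ((proj₁ x , proj₂ y) , ≈₁-refl , ≈₂-refl)

    productStructure-⊨Tsim : {T₁ : Theory L₁} {T₂ : Theory L₂} → IsModel N₁ T₁ → IsModel N₂ T₂ →
                             IsModel productStructure (Tsim d₁ d₂ T₁ T₂)
    productStructure-⊨Tsim N₁⊨T₁ N₂⊨T₂ σ (product p)    = productStructure-⊨T× σ p
    productStructure-⊨Tsim N₁⊨T₁ N₂⊨T₂ _ (axiom₁ {σ} p) = from (⊨-convert _ _ _ projection₁ σ []) (N₁⊨T₁ σ p)
    productStructure-⊨Tsim N₁⊨T₁ N₂⊨T₂ _ (axiom₂ {σ} p) = from (⊨-convert _ _ _ projection₂ σ []) (N₂⊨T₂ σ p)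
    productStructure-⊨Tsim N₁⊨T₁ N₂⊨T₂ _ (cong₁ R)      = ⊨-congruence _ _ _ projection₁ R
    productStructure-⊨Tsim N₁⊨T₁ N₂⊨T₂ _ (cong₂ R)      = ⊨-congruence _ _ _ projection₂ R

    module _ (em : ExcludedMiddle ℓ) {I : Set ℓ} {_<_ : Rel I ℓ} where

      -- The first projection is the given sequence, indiscernible over `A` and the constants. The
      -- second is constant, hence indiscernible over all of `N₂`, so `B₂` can be everything.
      indiscernible-section₁ : {a : I → Vec (Carrier N₁) m} (A : Pred (Carrier N₁) ℓ) → Indiscernible N₁ A _<_ a →
                               Indiscernible productStructure (A ∘ π₁) _<_ (map section₁ ∘ a)
      indiscernible-section₁ {m} {a} A ind = indiscernible-product d₁ d₂ em productStructure-simple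
        {A = A ∘ π₁} {B₁ = A ∪ IsConstant N₁} {B₂ = λ _ → ⊤}
        (λ { (inj₁ x∈A) → inj₁ x∈A ; (inj₂ ((c , _) , refl)) → inj₂ (c , refl) }) (λ _ → tt)
        (λ i → map-section π₁-section (a i))
        (λ i → trans (sym (Vec.map-∘ π₂ section₁ (a i))) (Vec.map-const (a i) _))
        (indiscernible-∪-constants N₁ A ind)
        (constant-indiscernible N₂ _ (replicate m (N₂.⟦con⟧ d₂)))

      indiscernible-section₂ : {a : I → Vec (Carrier N₂) m} (A : Pred (Carrier N₂) ℓ) → Indiscernible N₂ A _<_ a →
                               Indiscernible productStructure (A ∘ π₂) _<_ (map section₂ ∘ a)
      indiscernible-section₂ {m} {a} A ind = indiscernible-product d₁ d₂ em productStructure-simple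
        {A = A ∘ π₂} {B₁ = λ _ → ⊤} {B₂ = A ∪ IsConstant N₂}
        (λ _ → tt) (λ { (inj₁ x∈A) → inj₁ x∈A ; (inj₂ ((_ , c) , refl)) → inj₂ (c , refl) })
        (λ i → trans (sym (Vec.map-∘ π₁ section₂ (a i))) (Vec.map-const (a i) _))
        (λ i → map-section π₂-section (a i))
        (constant-indiscernible N₁ _ (replicate m (N₁.⟦con⟧ d₁)))
        (indiscernible-∪-constants N₂ A ind)

  -- Transfer of distality between the factors and the simple product.

  module _ (em : ExcludedMiddle ℓ) (T₁ : Theory L₁) (T₂ : Theory L₂) where

    -- A model of `T₂` serves as the second factor that turns every model of `T₁` into a projection
    -- of a model of the product theory.
    distal-Tsim⇒distal₁ : Satisfiable T₂ → Distal (Tsim d₁ d₂ T₁ T₂) → Distal T₁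
    distal-Tsim⇒distal₁ (N₂ , N₂⊨T₂) = distal-projection _ _ _ λ N₁ N₁⊨T₁ →
      productStructure N₁ N₂ , SimpleProduct.projection₁ (productStructure-simple N₁ N₂) ,
      productStructure-⊨Tsim N₁ N₂ N₁⊨T₁ N₂⊨T₂ , indiscernible-section₁ N₁ N₂ em

    distal-Tsim⇒distal₂ : Satisfiable T₁ → Distal (Tsim d₁ d₂ T₁ T₂) → Distal T₂
    distal-Tsim⇒distal₂ (N₁ , N₁⊨T₁) = distal-projection _ _ _ λ N₂ N₂⊨T₂ →
      productStructure N₁ N₂ , SimpleProduct.projection₂ (productStructure-simple N₁ N₂) ,
      productStructure-⊨Tsim N₁ N₂ N₁⊨T₁ N₂⊨T₂ , indiscernible-section₂ N₁ N₂ em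

    -- Distality of each factor is applied over `A⁺`, which adds the constants to `A` as
    -- `indiscernible-product` demands. Both quotients share the carrier of `M`, so `a` and `A⁺` are
    -- their own projections.
    distal₁×distal₂⇒distal-Tsim : Distal T₁ → Distal T₂ → Distal (Tsim d₁ d₂ T₁ T₂)
    distal₁×distal₂⇒distal-Tsim distal₁ distal₂ M M⊨T A _<₁_ _<₂_ order₁ order₂ a ind ind-A =
      indiscernible-product d₁ d₂ em simple {A = A} {B₁ = A⁺} {B₂ = A⁺} id id (Vec.map-id ∘ a) (Vec.map-id ∘ a)
        (distal₁ N₁ N₁⊨T₁ A⁺ _<₁_ _<₂_ order₁ order₂ a (reduct₁ ∅ ind) (reduct₁ A⁺ ind-A⁺))
        (distal₂ N₂ N₂⊨T₂ A⁺ _<₁_ _<₂_ order₁ order₂ a (reduct₂ ∅ ind) (reduct₂ A⁺ ind-A⁺))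
      where
      module M = Structure M

      module M/∼₁ = Quotient from₁ ∼₁ (λ c → c , d₂) em M (M⊨T _ (product refl₁)) (M⊨T _ (product sym₁))
             (M⊨T _ (product trans₁)) (λ R → M⊨T _ (cong₁ R))

      N₁ : Structure L₁
      N₁ = M/∼₁.quotient

      module M/∼₂ = Quotient from₂ ∼₂ (λ c → d₁ , c) em M (M⊨T _ (product refl₂)) (M⊨T _ (product sym₂))
             (M⊨T _ (product trans₂)) (λ R → M⊨T _ (cong₂ R))

      N₂ : Structure L₂
      N₂ = M/∼₂.quotient

      module N₁ = Structure N₁
      module N₂ = Structure N₂

      simple : SimpleProduct d₁ d₂ M N₁ N₂
      simple = record
        { projection₁ = M/∼₁.quotient-projection
        ; projection₂ = M/∼₂.quotient-projection
        ; ≈-⇔ = λ x y → mk⇔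
            -- In `x ∼₁ x` and `x ∼₂ x` the second entry is replaced by its equal `y`.
            (λ x≈y → M.pred-resp ∼₁ (≈-refl ∷ x≈y ∷ []) (Setoid.refl N₁.domain)
                   , M.pred-resp ∼₂ (≈-refl ∷ x≈y ∷ []) (Setoid.refl N₂.domain))
            (⇒-elim em (⊨-∀∗⁻ M em (⟨ suc zero , zero ⟩∈ ∼₁ ∧′ ⟨ suc zero , zero ⟩∈ ∼₂ ⇒′ var (suc zero) ≐ var zero)
                           (M⊨T _ (product unique)) (y ∷ x ∷ [])))
        ; amalgam = λ y₁ y₂ →
            let z , y₁≈z , y₂≈z = ⊨-∀∗⁻ M em (∃′ (⟨ suc (suc zero) , zero ⟩∈ ∼₁ ∧′ ⟨ suc zero , zero ⟩∈ ∼₂))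
                                        (M⊨T _ (product pair)) (y₂ ∷ y₁ ∷ [])
            in z , Setoid.sym N₁.domain y₁≈z , Setoid.sym N₂.domain y₂≈z
        }
        where open Setoid M.domain using () renaming (refl to ≈-refl)

      open SimpleProduct simple

      N₁⊨T₁ : IsModel N₁ T₁
      N₁⊨T₁ σ p = to (⊨-convert _ _ _ projection₁ σ []) (M⊨T _ (axiom₁ p))

      N₂⊨T₂ : IsModel N₂ T₂
      N₂⊨T₂ σ p = to (⊨-convert _ _ _ projection₂ σ []) (M⊨T _ (axiom₂ p))

      A⁺ : Pred (Carrier M) ℓ
      A⁺ = A ∪ IsConstant M

      ind-A⁺ : Indiscernible M A⁺ (_<₁_ <⁺ _<₂_) (a ∘ omit-c)
      ind-A⁺ = indiscernible-∪-constants M A ind-A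

      reduct₁ : (B : Pred (Carrier M) ℓ) {I : Set ℓ} {_<_ : Rel I ℓ} {b : I → Vec (Carrier M) n} →
                Indiscernible M B _<_ b → Indiscernible N₁ B _<_ b
      reduct₁ = M/∼₁.indiscernible-quotient

      reduct₂ : (B : Pred (Carrier M) ℓ) {I : Set ℓ} {_<_ : Rel I ℓ} {b : I → Vec (Carrier M) n} →
                Indiscernible M B _<_ b → Indiscernible N₂ B _<_ b
      reduct₂ = M/∼₂.indiscernible-quotient

theorem3p6 : {ℓ : Level} → ExcludedMiddle ℓ →
    (L₁ L₂ : Language ℓ) (d₁ : Constant L₁) (d₂ : Constant L₂)
    (T₁ : Theory L₁) (T₂ : Theory L₂) → Satisfiable T₁ → Satisfiable T₂ →
    Distal (Tsim d₁ d₂ T₁ T₂) ⇔ (Distal T₁ × Distal T₂)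
theorem3p6 em L₁ L₂ d₁ d₂ T₁ T₂ sat₁ sat₂ = mk⇔
  (λ distal → distal-Tsim⇒distal₁ d₁ d₂ em T₁ T₂ sat₂ distal , distal-Tsim⇒distal₂ d₁ d₂ em T₁ T₂ sat₁ distal)
  (λ (distal₁ , distal₂) → distal₁×distal₂⇒distal-Tsim d₁ d₂ em T₁ T₂ distal₁ distal₂)
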